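{- Let $p$ be a prime, $m\in\mathbb{N}$ with $m\ge 1$, $n=p^m$, and $S=\{a\in\mathbb{Z}_n \mid \gcd(a,n)=1\}$. Let $\Gamma=\mathrm{Cay}(\mathbb{Z}_n,S)$ be the Cayley graph on the cyclic group $\mathbb{Z}_n$ with connection set $S$. Then $$\mathrm{Aut}(\Gamma)\cong \mathrm{Sym}(p^{m-1})\ \mathrm{wr}_I\ \mathrm{Sym}(p),\qquad I=\{1,2,\dots,p\}.$$
   Context: For a finite group $G$ and an inverse-closed subset $H\subseteq G$ not containing the identity, $\mathrm{Cay}(G,H)$ is the simple undirected graph with vertex set $G$ in which $x,y$ are adjacent iff $x^{ -1}y\in H$. Here $G=\mathbb{Z}_n$ is the additive cyclic group, so $x,y$ are adjacent iff $y-x\in S$. $\mathrm{Aut}(\Gamma)$ is the group of graph automorphisms of $\Gamma$. $\mathrm{Sym}(k)$ is the symmetric group on $k$ points. For a group $A$, $A\ \mathrm{wr}_I\ \mathrm{Sym}(p)$ denotes the wreath product $A^I\rtimes \mathrm{Sym}(p)$, where $\mathrm{Sym}(p)$ acts on $A^I$ by permuting the coordinates indexed by $I$. -}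

module Defs where

open import Algebra.Bundles using (Group)
import Algebra.Construct.Pointwise as Pointwise
open import Algebra.Morphism.Structures using (module GroupMorphisms)
open import Data.Fin.Base using (Fin; toℕ)
open import Data.Fin.Properties using (toℕ-fromℕ<; toℕ-injective; toℕ<n; toℕ≤n)
open import Data.Nat.Base using (ℕ; NonZero; _+_; _∸_; _^_; _%_; _≤_; _<_; _≥_; z<s; >-nonZero; >-nonZero⁻¹; nonTrivial⇒nonZero; nonTrivial⇒n>1)
open import Data.Nat.Coprimality using (coprime⇒gcd≡1)
open import Data.Nat.Divisibility using (_∣_; _∣0; ∣-refl; ∣1⇒≡1; ∣m+n∣m⇒∣n; ∣n∣m%n⇒∣m)
open import Data.Nat.DivMod using (_mod_; m%n%n≡m%n; m<n⇒m%n≡m; n%n≡0; %-distribˡ-+; m%n<n)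
open import Data.Nat.GCD using (gcd; gcd-greatest)
open import Data.Nat.Primality using (Prime; prime)
open import Data.Nat.Properties using (+-assoc; +-comm; m∸n+n≡m; <⇒≢; <-trans; <-≤-trans; ^-identityʳ; ^-monoʳ-≤)
open import Data.Product.Base using (_×_; _,_; Σ-syntax)
import Function.Construct.Composition as Compose
import Function.Construct.Identity as Identity
import Function.Construct.Symmetry as Symmetry
open import Function.Bundles using (Inverse; _⇔_; mk⇔; Equivalence)
open import Level using (Level; 0ℓ; _⊔_)
open import Relation.Binary.Bundles using (Setoid)
open import Relation.Binary.PropositionalEquality using (_≡_; sym; trans; cong; cong₂; subst; setoid; isEquivalence; module ≡-Reasoning)
open import Relation.Nullary using (¬_)

private
  variable
    a b c ℓ ℓ₁ ℓ₂ : Level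

infix 4 _≅_

_≅_ : Group a ℓ₁ → Group b ℓ₂ → Set (a ⊔ b ⊔ ℓ₁ ⊔ ℓ₂)
G ≅ H = Σ[ f ∈ (Group.Carrier G → Group.Carrier H) ] IsGroupIsomorphism f
  where open GroupMorphisms (Group.rawGroup G) (Group.rawGroup H)

-- The product σ ∙ τ means "first τ, then σ".
SymmetricGroup : Setoid a ℓ → Group (a ⊔ ℓ) (a ⊔ ℓ)
SymmetricGroup X = record
  { Carrier = Inverse X X
  ; _≈_     = λ σ τ → ∀ x → to σ x ≈ to τ x
  ; _∙_     = λ σ τ → Compose.inverse τ σ
  ; ε       = Identity.inverse X
  ; _⁻¹     = Symmetry.inverse
  ; isGroup = record
    { isMonoid = record
      { isSemigroup = record
        { isMagma = record
          { isEquivalence = record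
            { refl  = λ _ → X.refl
            ; sym   = λ p x → X.sym (p x)
            ; trans = λ p q x → X.trans (p x) (q x)
            }
          ; ∙-cong = λ {σ} {σ′} {τ} {τ′} p q x →
              X.trans (to-cong σ (q x)) (p (to τ′ x))
          }
        ; assoc = λ _ _ _ _ → X.refl
        }
      ; identity = (λ _ _ → X.refl) , (λ _ _ → X.refl)
      }
    ; inverse = (λ σ _ → inverseʳ σ X.refl) , (λ σ _ → inverseˡ σ X.refl)
    ; ⁻¹-cong = λ {σ} {τ} p x →
        inverseʳ σ (X.trans (X.sym (inverseˡ τ X.refl)) (X.sym (p (from τ x))))
    }
  }
  where
  module X = Setoid X
  open X using (_≈_)
  open Inverse

Sym : ℕ → Group 0ℓ 0ℓ
Sym k = SymmetricGroup (setoid (Fin k))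

-- A left action of H on N by group endomorphisms; by act-ε and act-∙ these
-- are automatically automorphisms.
record ActsByAutomorphisms (H : Group a ℓ₁) (N : Group b ℓ₂) : Set (a ⊔ b ⊔ ℓ₁ ⊔ ℓ₂) where
  private
    module H = Group H
    module N = Group N
  infixr 8 _▷_
  field
    _▷_    : H.Carrier → N.Carrier → N.Carrier
    ▷-cong : ∀ {h h′ x x′} → h H.≈ h′ → x N.≈ x′ → h ▷ x N.≈ h′ ▷ x′
    ▷-homo : ∀ h x y → h ▷ (x N.∙ y) N.≈ (h ▷ x) N.∙ (h ▷ y)
    act-ε  : ∀ x → H.ε ▷ x N.≈ x
    act-∙  : ∀ h k x → (h H.∙ k) ▷ x N.≈ h ▷ (k ▷ x)

  ▷-ε : ∀ h → h ▷ N.ε N.≈ N.ε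
  ▷-ε h = identityʳ-unique (h ▷ N.ε) (h ▷ N.ε)
    (N.trans (N.sym (▷-homo h N.ε N.ε)) (▷-cong H.refl (N.identityˡ N.ε)))
    where open import Algebra.Properties.Group N using (identityʳ-unique)

SemidirectProduct : (N : Group b ℓ₂) (H : Group a ℓ₁) → ActsByAutomorphisms H N → Group (a ⊔ b) (ℓ₁ ⊔ ℓ₂)
SemidirectProduct N H φ = record
  { Carrier = N.Carrier × H.Carrier
  ; _≈_     = λ (x , h) (y , k) → x N.≈ y × h H.≈ k
  ; _∙_     = λ (x , h) (y , k) → x N.∙ (h ▷ y) , h H.∙ k
  ; ε       = N.ε , H.ε
  ; _⁻¹     = λ (x , h) → (h H.⁻¹) ▷ (x N.⁻¹) , h H.⁻¹
  ; isGroup = record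
    { isMonoid = record
      { isSemigroup = record
        { isMagma = record
          { isEquivalence = record
            { refl  = N.refl , H.refl
            ; sym   = λ (p , q) → N.sym p , H.sym q
            ; trans = λ (p , q) (p′ , q′) → N.trans p p′ , H.trans q q′
            }
          ; ∙-cong = λ (p , q) (p′ , q′) → N.∙-cong p (▷-cong q p′) , H.∙-cong q q′
          }
        ; assoc = λ (x , h) (y , k) (z , l) →
            N.trans (N.assoc x (h ▷ y) ((h H.∙ k) ▷ z))
              (N.∙-congˡ (N.trans (N.∙-congˡ (act-∙ h k z)) (N.sym (▷-homo h y (k ▷ z)))))
            , H.assoc h k l
        }
      ; identity =
          (λ (x , h) → N.trans (N.identityˡ _) (act-ε x) , H.identityˡ h)
        , (λ (x , h) → N.trans (N.∙-congˡ (▷-ε h)) (N.identityʳ x) , H.identityʳ h)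
      }
    ; inverse =
        (λ (x , h) →
            N.trans (N.sym (▷-homo (h H.⁻¹) (x N.⁻¹) x))
              (N.trans (▷-cong H.refl (N.inverseˡ x)) (▷-ε (h H.⁻¹)))
          , H.inverseˡ h)
      , (λ (x , h) →
            N.trans (N.∙-congˡ (N.trans (N.sym (act-∙ h (h H.⁻¹) (x N.⁻¹)))
              (N.trans (▷-cong (H.inverseʳ h) N.refl) (act-ε (x N.⁻¹))))) (N.inverseʳ x)
          , H.inverseʳ h)
    ; ⁻¹-cong = λ (p , q) → ▷-cong (H.⁻¹-cong q) (N.⁻¹-cong p) , H.⁻¹-cong q
    }
  }
  where
  module N = Group N
  module H = Group H
  open ActsByAutomorphisms φ

-- σ moves the coordinate at i to position σ i, i.e. (σ ▷ f) i = f (σ⁻¹ i).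
permuteCoordinates : (A : Group c ℓ) (k : ℕ) →
                     ActsByAutomorphisms (Sym k) (Pointwise.group (Fin k) A)
permuteCoordinates A k = record
  { _▷_    = λ σ f i → f (Inverse.from σ i)
  ; ▷-cong = λ {σ} {τ} {f} p q i →
      A.trans (A.reflexive (cong f (Group.⁻¹-cong (Sym k) {σ} {τ} p i))) (q _)
  ; ▷-homo = λ _ _ _ _ → A.refl
  ; act-ε  = λ _ _ → A.refl
  ; act-∙  = λ _ _ _ _ → A.refl
  }
  where module A = Group A

infix 5 _wrSym_

-- The index set I is Fin k, with its natural action of Sym k.
_wrSym_ : Group c ℓ → ℕ → Group c ℓ
A wrSym k = SemidirectProduct (Pointwise.group (Fin k) A) (Sym k) (permuteCoordinates A k)

record SimpleGraph (c ℓ : Level) : Set (Level.suc (c ⊔ ℓ)) where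
  field
    vertices   : Setoid c ℓ
  open Setoid vertices public using (_≈_) renaming (Carrier to Vertex)
  field
    Adj        : Vertex → Vertex → Set ℓ
    Adj-resp   : ∀ {x x′ y y′} → x ≈ x′ → y ≈ y′ → Adj x y → Adj x′ y′
    Adj-sym    : ∀ {x y} → Adj x y → Adj y x
    Adj-irrefl : ∀ {x} → ¬ Adj x x

module _ (Γ : SimpleGraph c ℓ) where
  open SimpleGraph Γ
  private
    module S = Group (SymmetricGroup vertices)
    module V = Setoid vertices

  IsAutomorphism : Inverse vertices vertices → Set (c ⊔ ℓ)
  IsAutomorphism σ = ∀ x y → Adj x y ⇔ Adj (to x) (to y)
    where open Inverse σ

  -- Two automorphisms are equal when the underlying permutations are.
  Aut : Group (c ⊔ ℓ) (c ⊔ ℓ)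
  Aut = record
    { Carrier = Σ[ σ ∈ Inverse vertices vertices ] IsAutomorphism σ
    ; _≈_     = λ (σ , _) (τ , _) → σ S.≈ τ
    ; _∙_     = λ (σ , p) (τ , q) → σ S.∙ τ , λ x y → mk⇔
        (λ e → Equivalence.to (p _ _) (Equivalence.to (q x y) e))
        (λ e → Equivalence.from (q x y) (Equivalence.from (p _ _) e))
    ; ε       = S.ε , λ x y → mk⇔ (λ e → e) (λ e → e)
    ; _⁻¹     = λ (σ , p) → σ S.⁻¹ , λ x y → mk⇔
        (λ e → Equivalence.from (p _ _) (Adj-resp (V.sym (σσ⁻¹ σ x)) (V.sym (σσ⁻¹ σ y)) e))
        (λ e → Adj-resp (σσ⁻¹ σ x) (σσ⁻¹ σ y) (Equivalence.to (p _ _) e))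
    ; isGroup = record
      { isMonoid = record
        { isSemigroup = record
          { isMagma = record
            { isEquivalence = record
              { refl  = λ _ → V.refl
              ; sym   = λ p x → V.sym (p x)
              ; trans = λ p q x → V.trans (p x) (q x)
              }
            ; ∙-cong = λ {(σ , _)} {(σ′ , _)} {(τ , _)} {(τ′ , _)} → S.∙-cong {σ} {σ′} {τ} {τ′}
            }
          ; assoc = λ _ _ _ _ → V.refl
          }
        ; identity = (λ _ _ → V.refl) , (λ _ _ → V.refl)
        }
      ; inverse = (λ (σ , _) → S.inverseˡ σ) , (λ (σ , _) → S.inverseʳ σ)
      ; ⁻¹-cong = λ {(σ , _)} {(τ , _)} → S.⁻¹-cong {σ} {τ}
      }
    }
    where
    σσ⁻¹ : ∀ (σ : Inverse vertices vertices) x → Inverse.to σ (Inverse.from σ x) ≈ x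
    σσ⁻¹ σ _ = Inverse.inverseˡ σ V.refl

record ConnectionSet (G : Group c ℓ) : Set (c ⊔ Level.suc ℓ) where
  open Group G
  field
    Member         : Carrier → Set ℓ
    resp           : ∀ {x y} → x ≈ y → Member x → Member y
    inverse-closed : ∀ {x} → Member x → Member (x ⁻¹)
    ε∉             : ¬ Member ε

Cay : (G : Group c ℓ) → ConnectionSet G → SimpleGraph c ℓ
Cay G H = record
  { vertices   = G.setoid
  ; Adj        = λ x y → Member (x G.⁻¹ G.∙ y)
  ; Adj-resp   = λ p q → resp (G.∙-cong (G.⁻¹-cong p) q)
  ; Adj-sym    = λ {x} {y} e → resp
      (G.trans (⁻¹-anti-homo-∙ (x G.⁻¹) y) (G.∙-congˡ (⁻¹-involutive x)))
      (inverse-closed e)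
  ; Adj-irrefl = λ {x} e → ε∉ (resp (G.inverseˡ x) e)
  }
  where
  module G = Group G
  open ConnectionSet H
  open import Algebra.Properties.Group G using (⁻¹-anti-homo-∙; ⁻¹-involutive)

toℕ-mod : ∀ k n .{{_ : NonZero n}} → toℕ (k mod n) ≡ k % n
toℕ-mod k n = toℕ-fromℕ< (m%n<n k n)

toℕ-% : ∀ {n} .{{_ : NonZero n}} (x : Fin n) → toℕ x % n ≡ toℕ x
toℕ-% x = m<n⇒m%n≡m (toℕ<n x)

%-+ˡ : ∀ j k n .{{_ : NonZero n}} → (j % n + k) % n ≡ (j + k) % n
%-+ˡ j k n = trans (%-distribˡ-+ (j % n) k n)
  (trans (cong (λ r → (r + k % n) % n) (m%n%n≡m%n j n)) (sym (%-distribˡ-+ j k n)))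

%-+ʳ : ∀ j k n .{{_ : NonZero n}} → (j + k % n) % n ≡ (j + k) % n
%-+ʳ j k n = trans (cong (_% n) (+-comm j (k % n)))
  (trans (%-+ˡ k j n) (cong (_% n) (+-comm k j)))

-- The residues 0, …, n − 1 under addition modulo n.
ℤ/ : (n : ℕ) .{{_ : NonZero n}} → Group 0ℓ 0ℓ
ℤ/ n = record
  { Carrier = Fin n
  ; _≈_     = _≡_
  ; _∙_     = _⊕_
  ; ε       = 0 mod n
  ; _⁻¹     = ⊖_
  ; isGroup = record
    { isMonoid = record
      { isSemigroup = record
        { isMagma = record { isEquivalence = isEquivalence ; ∙-cong = cong₂ _⊕_ }
        ; assoc   = assoc
        }
      ; identity = identityˡ , λ x → trans (comm x _) (identityˡ x)
      }
    ; inverse = inverseˡ , λ x → trans (comm x _) (inverseˡ x)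
    ; ⁻¹-cong = cong ⊖_
    }
  }
  where
  _⊕_ : Fin n → Fin n → Fin n
  x ⊕ y = (toℕ x + toℕ y) mod n

  ⊖_ : Fin n → Fin n
  ⊖ x = (n ∸ toℕ x) mod n

  comm : ∀ x y → x ⊕ y ≡ y ⊕ x
  comm x y = cong (_mod n) (+-comm (toℕ x) (toℕ y))

  assoc : ∀ x y z → (x ⊕ y) ⊕ z ≡ x ⊕ (y ⊕ z)
  assoc x y z = toℕ-injective (begin
    toℕ ((x ⊕ y) ⊕ z)                    ≡⟨ toℕ-mod _ n ⟩
    (toℕ (x ⊕ y) + toℕ z) % n            ≡⟨ cong (λ k → (k + toℕ z) % n) (toℕ-mod _ n) ⟩
    ((toℕ x + toℕ y) % n + toℕ z) % n    ≡⟨ %-+ˡ (toℕ x + toℕ y) (toℕ z) n ⟩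
    (toℕ x + toℕ y + toℕ z) % n          ≡⟨ cong (_% n) (+-assoc (toℕ x) _ _) ⟩
    (toℕ x + (toℕ y + toℕ z)) % n        ≡⟨ %-+ʳ (toℕ x) (toℕ y + toℕ z) n ⟨
    (toℕ x + (toℕ y + toℕ z) % n) % n    ≡⟨ cong (λ k → (toℕ x + k) % n) (toℕ-mod _ n) ⟨
    (toℕ x + toℕ (y ⊕ z)) % n            ≡⟨ toℕ-mod _ n ⟨
    toℕ (x ⊕ (y ⊕ z))                    ∎)
    where open ≡-Reasoning

  identityˡ : ∀ x → (0 mod n) ⊕ x ≡ x
  identityˡ x = toℕ-injective (trans (toℕ-mod _ n)
    (trans (cong (λ k → (k + toℕ x) % n) (toℕ-mod 0 n))
      (trans (%-+ˡ 0 (toℕ x) n) (toℕ-% x))))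

  inverseˡ : ∀ x → (⊖ x) ⊕ x ≡ 0 mod n
  inverseˡ x = toℕ-injective (begin
    toℕ ((⊖ x) ⊕ x)                  ≡⟨ toℕ-mod _ n ⟩
    (toℕ (⊖ x) + toℕ x) % n          ≡⟨ cong (λ k → (k + toℕ x) % n) (toℕ-mod _ n) ⟩
    ((n ∸ toℕ x) % n + toℕ x) % n    ≡⟨ %-+ˡ (n ∸ toℕ x) (toℕ x) n ⟩
    (n ∸ toℕ x + toℕ x) % n          ≡⟨ cong (_% n) (m∸n+n≡m (toℕ≤n x)) ⟩
    n % n                            ≡⟨ n%n≡0 n ⟩
    0                                ≡⟨ m<n⇒m%n≡m (>-nonZero⁻¹ n) ⟨
    0 % n                            ≡⟨ toℕ-mod 0 n ⟨
    toℕ (0 mod n)                    ∎)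
    where open ≡-Reasoning

-- The hypothesis 1 < n is what makes 0 a non-member: gcd(0, n) = n.
CoprimeResidues : (n : ℕ) .{{_ : NonZero n}} → 1 < n → ConnectionSet (ℤ/ n)
CoprimeResidues n 1<n = record
  { Member         = λ a → gcd (toℕ a) n ≡ 1
  ; resp           = λ p → subst (λ a → gcd (toℕ a) n ≡ 1) p
  ; inverse-closed = λ {a} p → coprime⇒gcd≡1 λ {d} (d∣-a , d∣n) →
      let d∣n∸a : d ∣ n ∸ toℕ a
          d∣n∸a = ∣n∣m%n⇒∣m d∣n (subst (d ∣_) (toℕ-mod (n ∸ toℕ a) n) d∣-a)
          d∣a   : d ∣ toℕ a
          d∣a   = ∣m+n∣m⇒∣n (subst (d ∣_) (sym (m∸n+n≡m (toℕ≤n a))) d∣n) d∣n∸a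
      in ∣1⇒≡1 (subst (d ∣_) p (gcd-greatest d∣a d∣n))
  ; ε∉             = λ p → <⇒≢ 1<n (sym (∣1⇒≡1
      (subst (n ∣_) p (gcd-greatest
        (subst (n ∣_) (sym (trans (toℕ-mod 0 n) (m<n⇒m%n≡m (>-nonZero⁻¹ n)))) (n ∣0))
        ∣-refl))))
  }

1<p^m : ∀ {p m} → Prime p → m ≥ 1 → 1 < p ^ m
1<p^m {p} {m} (prime _) m≥1 = <-≤-trans (nonTrivial⇒n>1 p)
  (subst (_≤ p ^ m) (^-identityʳ p) (^-monoʳ-≤ p {{nonTrivial⇒nonZero p}} m≥1))

UnitaryCayleyGraph : (n : ℕ) → 1 < n → SimpleGraph 0ℓ 0ℓ
UnitaryCayleyGraph n 1<n = Cay (ℤ/ n) (CoprimeResidues n 1<n)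
  where instance _ = >-nonZero (<-trans z<s 1<n)

{-# OPTIONS --safe #-}
module Submission where

-- Modulo p^m, a residue is a unit iff p does not divide it, so x and y are adjacent iff
-- x ≢ y (mod p): the graph is complete multipartite, its parts being the p residue classes
-- mod p, each of size p^(m-1).  Non-adjacency is then an equivalence relation, so an
-- automorphism permutes the parts; conversely every permutation of the parts together with
-- arbitrary bijections between them is an automorphism.

open import Defs
open import Algebra.Bundles using (Group)
open import Data.Fin.Base using (Fin; toℕ; fromℕ<; cast; combine; remainder; quotient)
open import Data.Fin.Permutation using (cast-id)
open import Data.Fin.Properties using (_≟_; *↔×; combine-remQuot; toℕ-cast; toℕ-combine; toℕ-injective; toℕ<n; toℕ≤n)
open import Data.Nat.Base using (ℕ; suc; NonZero; _+_; _*_; _^_; _∸_; _%_; _≤_; _<_; _≥_; >-nonZero; nonTrivial⇒≢1; z<s)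
open import Data.Nat.Coprimality using (Coprime; 1-coprimeTo; coprime-divisor; coprime⇒gcd≡1) renaming (sym to coprime-sym)
open import Data.Nat.Divisibility using (_∣_; ∣-trans; ∣1⇒≡1; m∣m*n; m%n≡0⇒n∣m; n∣m⇒m%n≡0; ∣n∣m%n⇒∣m; %-presˡ-∣)
open import Data.Nat.DivMod using (m<n⇒m%n≡m; %-remove-+ˡ)
open import Data.Nat.GCD using (gcd; gcd-greatest)
open import Data.Nat.Primality using (Prime; prime⇒irreducible; prime⇒nonZero; prime⇒nonTrivial)
open import Data.Nat.Properties using (+-assoc; +-comm; *-comm; m∸n+n≡m; m^n>0; <-trans)
open import Data.Product.Algebra using (×-comm)
open import Data.Product.Base using (_×_; _,_; proj₁; proj₂)
open import Data.Sum.Base using (inj₁; inj₂)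
open import Function.Base using (_∘_)
open import Function.Bundles using (Inverse; _⇔_; _↔_; mk⇔; mk↔ₛ′; Equivalence)
import Function.Construct.Composition as Compose
open import Level using (Level)
open import Relation.Binary.Bundles using (Setoid)
open import Relation.Binary.PropositionalEquality using (_≡_; refl; sym; trans; cong; cong₂; subst; setoid; module ≡-Reasoning)
open import Relation.Nullary using (¬_; contradiction)
open import Relation.Nullary.Decidable using (decidable-stable)

-- Complete multipartite graphs

module CompleteMultipartite {c ℓ : Level} (Γ : SimpleGraph c ℓ) {q k : ℕ}
  (coordinates : Inverse (SimpleGraph.vertices Γ) (setoid (Fin q × Fin k)))
  (Adj⇔≢ : ∀ x y → SimpleGraph.Adj Γ x y ⇔ (¬ proj₁ (Inverse.to coordinates x) ≡ proj₁ (Inverse.to coordinates y)))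
  -- A base point for every part, used to read off how automorphisms move the parts. If `k` were 0
  -- the graph would be empty, while the wreath product would still contain `Sym q`.
  (o : Fin k)
  where

  open SimpleGraph Γ

  private
    module V = Setoid vertices
    module A = Group (Aut Γ)
    module W = Group (Sym k wrSym q)
    open Inverse

    part : Vertex → Fin q
    part x = proj₁ (to coordinates x)

    place : Vertex → Fin k
    place x = proj₂ (to coordinates x)

    at : Fin q → Fin k → Vertex
    at i j = from coordinates (i , j)

    part-cong : ∀ {x y} → x ≈ y → part x ≡ part y
    part-cong x≈y = cong proj₁ (to-cong coordinates x≈y)

    place-cong : ∀ {x y} → x ≈ y → place x ≡ place y
    place-cong x≈y = cong proj₂ (to-cong coordinates x≈y)

    part-at : ∀ i j → part (at i j) ≡ i
    part-at i j = cong proj₁ (inverseˡ coordinates V.refl)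

    place-at : ∀ i j → place (at i j) ≡ j
    place-at i j = cong proj₂ (inverseˡ coordinates V.refl)

    at-cong : ∀ {i i′ j j′} → i ≡ i′ → j ≡ j′ → at i j ≈ at i′ j′
    at-cong refl refl = V.refl

    at-part-place : ∀ x → at (part x) (place x) ≈ x
    at-part-place x = inverseʳ coordinates refl

    at-unique : ∀ {x i j} → part x ≡ i → place x ≡ j → x ≈ at i j
    at-unique {x} refl refl = V.sym (at-part-place x)

  _⟪_⟫ : A.Carrier → Vertex → Vertex
  (σ , _) ⟪ x ⟫ = to σ x

  -- The action of an automorphism on the parts and inside them

  private
    ⟪⟫-cong : ∀ s {x y} → x ≈ y → s ⟪ x ⟫ ≈ s ⟪ y ⟫
    ⟪⟫-cong (σ , _) = to-cong σ

    -- Images in different parts would be adjacent, hence so would `x` and `y`, which share a part.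
    -- Equality in `Fin q` is decidable, so this refutation suffices.
    same-part : ∀ s {x y} → part x ≡ part y → part (s ⟪ x ⟫) ≡ part (s ⟪ y ⟫)
    same-part (_ , aut) {x} {y} eq = decidable-stable (_ ≟ _) λ neq →
      Equivalence.to (Adj⇔≢ x y)
        (Equivalence.from (aut x y) (Equivalence.from (Adj⇔≢ _ _) neq)) eq

    blockMap : A.Carrier → Fin q → Fin q
    blockMap s i = part (s ⟪ at i o ⟫)

    part-⟪⟫ : ∀ s x → part (s ⟪ x ⟫) ≡ blockMap s (part x)
    part-⟪⟫ s x = same-part s (sym (part-at (part x) o))

    part-⟪at⟫ : ∀ s i j → part (s ⟪ at i j ⟫) ≡ blockMap s i
    part-⟪at⟫ s i j = trans (part-⟪⟫ s _) (cong (blockMap s) (part-at i j))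

    blockMap-∙ : ∀ s t i → blockMap (s A.∙ t) i ≡ blockMap s (blockMap t i)
    blockMap-∙ s t i = part-⟪⟫ s (t ⟪ at i o ⟫)

    blockMap-inverseʳ : ∀ s i → blockMap s (blockMap (s A.⁻¹) i) ≡ i
    blockMap-inverseʳ s i = begin
      blockMap s (blockMap (s A.⁻¹) i)   ≡⟨ blockMap-∙ s (s A.⁻¹) i ⟨
      part (s ⟪ (s A.⁻¹) ⟪ at i o ⟫ ⟫)   ≡⟨ part-cong (A.inverseʳ s (at i o)) ⟩
      part (at i o)                      ≡⟨ part-at i o ⟩
      i                                  ∎
      where open ≡-Reasoning

    blockMap-inverseˡ : ∀ s i → blockMap (s A.⁻¹) (blockMap s i) ≡ i
    blockMap-inverseˡ s i = begin
      blockMap (s A.⁻¹) (blockMap s i)   ≡⟨ blockMap-∙ (s A.⁻¹) s i ⟨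
      part ((s A.⁻¹) ⟪ s ⟪ at i o ⟫ ⟫)   ≡⟨ part-cong (A.inverseˡ s (at i o)) ⟩
      part (at i o)                      ≡⟨ part-at i o ⟩
      i                                  ∎
      where open ≡-Reasoning

    at-place-⟪⟫ : ∀ s {i i′} j → blockMap s i ≡ i′ → at i′ (place (s ⟪ at i j ⟫)) ≈ s ⟪ at i j ⟫
    at-place-⟪⟫ s j refl = V.sym (at-unique (part-⟪at⟫ s _ j) refl)

    -- Indexed by the target part: this is the bijection from the part that `s` sends to `i` onto
    -- part `i`, read in places. The action `(σ ▷ f) i = f (σ⁻¹ i)` in the wreath product forces
    -- this choice.
    fibre : A.Carrier → Fin q → Fin k ↔ Fin k
    fibre s i = mk↔ₛ′
      (λ j → place (s ⟪ at (blockMap (s A.⁻¹) i) j ⟫))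
      (λ j → place ((s A.⁻¹) ⟪ at i j ⟫))
      (λ j → trans
        (place-cong (V.trans (⟪⟫-cong s (at-place-⟪⟫ (s A.⁻¹) j refl)) (A.inverseʳ s (at i j))))
        (place-at i j))
      (λ j → trans
        (place-cong (V.trans
          (⟪⟫-cong (s A.⁻¹) (at-place-⟪⟫ s j (blockMap-inverseʳ s i)))
          (A.inverseˡ s _)))
        (place-at _ j))

    blocks : A.Carrier → Fin q ↔ Fin q
    blocks s = mk↔ₛ′ (blockMap s) (blockMap (s A.⁻¹)) (blockMap-inverseʳ s) (blockMap-inverseˡ s)

  toWreath : A.Carrier → W.Carrier
  toWreath s = fibre s , blocks s

  private
    toWreath-cong : ∀ s t → s A.≈ t → toWreath s W.≈ toWreath t
    toWreath-cong s t s≈t =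
        (λ i j → place-cong (V.trans
          (⟪⟫-cong s (at-cong (part-cong (A.⁻¹-cong {s} {t} s≈t (at i o))) refl))
          (s≈t _)))
      , λ i → part-cong (s≈t (at i o))

    toWreath-∙ : ∀ s t → toWreath (s A.∙ t) W.≈ toWreath s W.∙ toWreath t
    toWreath-∙ s t = onFibre , blockMap-∙ s t
      where
      onFibre : ∀ i j → to (fibre (s A.∙ t) i) j ≡ to (fibre s i) (to (fibre t (blockMap (s A.⁻¹) i)) j)
      -- The image under `t` lies in part `blockMap (s A.⁻¹) i`, so rebuilding it from that part and
      -- its place gives back the same vertex.
      onFibre i j = place-cong (⟪⟫-cong s (V.trans
        (⟪⟫-cong t (at-cong (blockMap-∙ (t A.⁻¹) (s A.⁻¹) i) refl))
        (V.sym (at-place-⟪⟫ t j (blockMap-inverseʳ t (blockMap (s A.⁻¹) i))))))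

    toWreath-ε : toWreath A.ε W.≈ W.ε
    toWreath-ε = (λ i j → place-at _ j) , λ i → part-at i o

    toWreath-⁻¹ : ∀ s → toWreath (s A.⁻¹) W.≈ toWreath s W.⁻¹
    toWreath-⁻¹ s = (λ i j → refl) , λ i → refl

    -- With `part-⟪⟫`, this expresses both coordinates of an image through `toWreath s`, which is
    -- what injectivity needs.
    place-⟪⟫ : ∀ s x → place (s ⟪ x ⟫) ≡ to (fibre s (blockMap s (part x))) (place x)
    place-⟪⟫ s x = place-cong (⟪⟫-cong s
      (at-unique (sym (blockMap-inverseˡ s (part x))) refl))

    toWreath-injective : ∀ s t → toWreath s W.≈ toWreath t → s A.≈ t
    toWreath-injective s t (fibre≈ , blocks≈) x = V.trans
      (at-unique
        (trans (part-⟪⟫ s x) (trans (blocks≈ (part x)) (sym (part-⟪⟫ t x))))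
        (begin
          place (s ⟪ x ⟫)                                ≡⟨ place-⟪⟫ s x ⟩
          to (fibre s (blockMap s (part x))) (place x)   ≡⟨ fibre≈ _ _ ⟩
          to (fibre t (blockMap s (part x))) (place x)   ≡⟨ cong (λ i → to (fibre t i) (place x)) (blocks≈ (part x)) ⟩
          to (fibre t (blockMap t (part x))) (place x)   ≡⟨ place-⟪⟫ t x ⟨
          place (t ⟪ x ⟫)                                ∎))
      (at-part-place (t ⟪ x ⟫))
      where open ≡-Reasoning

    -- The automorphism built from a wreath product element

    module FromWreath (g : Fin q → Fin k ↔ Fin k) (π : Fin q ↔ Fin q) where

      forward backward : Vertex → Vertex
      -- `g` is taken at the part where `x` arrives, matching the indexing of `fibre`.
      forward x  = at (to π (part x)) (to (g (to π (part x))) (place x))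
      backward x = at (from π (part x)) (from (g (part x)) (place x))

      forward-cong : ∀ {x y} → x ≈ y → forward x ≈ forward y
      forward-cong x≈y rewrite to-cong coordinates x≈y = V.refl

      backward-cong : ∀ {x y} → x ≈ y → backward x ≈ backward y
      backward-cong x≈y rewrite to-cong coordinates x≈y = V.refl

      part-forward : ∀ x → part (forward x) ≡ to π (part x)
      part-forward x = part-at _ _

      forward∘backward : ∀ x → forward (backward x) ≈ x
      forward∘backward x = V.sym (at-unique (sym block) (sym (begin
        to (g (to π (part (backward x)))) (place (backward x))   ≡⟨ cong₂ (λ i → to (g i)) block (place-at _ _) ⟩
        to (g (part x)) (from (g (part x)) (place x))            ≡⟨ inverseˡ (g (part x)) refl ⟩
        place x                                                  ∎)))
        where
        open ≡-Reasoning
        block : to π (part (backward x)) ≡ part x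
        block = inverseˡ π (part-at _ _)

      backward∘forward : ∀ x → backward (forward x) ≈ x
      backward∘forward x = V.sym (at-unique
        (sym (inverseʳ π (part-forward x)))
        (sym (begin
          from (g (part (forward x))) (place (forward x))               ≡⟨ cong₂ (λ i → from (g i)) (part-forward x) (place-at _ _) ⟩
          from (g (to π (part x))) (to (g (to π (part x))) (place x))   ≡⟨ inverseʳ (g (to π (part x))) refl ⟩
          place x                                                       ∎)))
        where open ≡-Reasoning

      permutation : Inverse vertices vertices
      permutation = record
        { to        = forward
        ; from      = backward
        ; to-cong   = forward-cong
        ; from-cong = backward-cong
        ; inverse   = (λ {x} y≈ → V.trans (forward-cong y≈) (forward∘backward x))
                    , (λ {x} y≈ → V.trans (backward-cong y≈) (backward∘forward x))
        }

      isAutomorphism : IsAutomorphism Γ permutation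
      -- By contraposition: adjacency means distinct parts, and `π` acts injectively on parts.
      isAutomorphism x y = mk⇔
        (λ xy → Equivalence.from (Adj⇔≢ _ _) λ eq → Equivalence.to (Adj⇔≢ x y) xy (begin
          part x                    ≡⟨ inverseʳ π (part-forward x) ⟨
          from π (part (forward x)) ≡⟨ cong (from π) eq ⟩
          from π (part (forward y)) ≡⟨ inverseʳ π (part-forward y) ⟩
          part y                    ∎))
        (λ xy → Equivalence.from (Adj⇔≢ x y) λ eq → Equivalence.to (Adj⇔≢ _ _) xy (begin
          part (forward x)         ≡⟨ part-forward x ⟩
          to π (part x)            ≡⟨ cong (to π) eq ⟩
          to π (part y)            ≡⟨ part-forward y ⟨
          part (forward y)         ∎))
        where open ≡-Reasoning

      automorphism : A.Carrier
      automorphism = permutation , isAutomorphism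

      toWreath-automorphism : toWreath automorphism W.≈ (g , π)
      toWreath-automorphism = onFibre , onBlocks
        where
        onBlocks : ∀ i → blockMap automorphism i ≡ to π i
        onBlocks i = trans (part-forward _) (cong (to π) (part-at i o))

        onFibre : ∀ i j → to (fibre automorphism i) j ≡ to (g i) j
        -- The fibre starts in part `blockMap (automorphism A.⁻¹) i`, which `π` carries back to `i`;
        -- hence the component applied is `g i`.
        onFibre i j = trans (place-at _ _) (cong₂ (λ i′ → to (g i′))
          (trans (cong (to π) (part-at _ j))
            (trans (sym (onBlocks _)) (blockMap-inverseʳ automorphism i)))
          (place-at _ j))

      toWreath-surjective : ∀ z → z A.≈ automorphism → toWreath z W.≈ (g , π)
      toWreath-surjective z z≈ = W.trans {toWreath z} {toWreath automorphism} {g , π}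
        (toWreath-cong z automorphism z≈) toWreath-automorphism

  Aut≅wreath : Aut Γ ≅ Sym k wrSym q
  Aut≅wreath = toWreath , record
    { isGroupMonomorphism = record
      { isGroupHomomorphism = record
        { isMonoidHomomorphism = record
          { isMagmaHomomorphism = record
            { isRelHomomorphism = record { cong = λ {s} {t} → toWreath-cong s t }
            ; homo              = toWreath-∙
            }
          ; ε-homo = toWreath-ε
          }
        ; ⁻¹-homo = toWreath-⁻¹
        }
      ; injective = λ {s} {t} → toWreath-injective s t
      }
    ; surjective = λ (g , π) → FromWreath.automorphism g π , λ {z} → FromWreath.toWreath-surjective g π z
    }

-- Residues modulo a prime power

-- A common divisor `d` of `a` and `b * c` is coprime to `b` because it divides `a`; so it divides
-- `c`, and then `d` is 1.
coprime-* : ∀ {a b c} → Coprime a b → Coprime a c → Coprime a (b * c)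
coprime-* {a} {b} a⊥b a⊥c {d} (d∣a , d∣bc) = a⊥c (d∣a , coprime-divisor d⊥b d∣bc)
  where
  d⊥b : Coprime d b
  d⊥b (e∣d , e∣b) = a⊥b (∣-trans e∣d d∣a , e∣b)

coprime-^ : ∀ {a b} m → Coprime a b → Coprime a (b ^ m)
coprime-^ 0       a⊥b = coprime-sym (1-coprimeTo _)
coprime-^ (suc m) a⊥b = coprime-* a⊥b (coprime-^ m a⊥b)

prime∤⇒coprime : ∀ {p a} → Prime p → ¬ p ∣ a → Coprime a p
prime∤⇒coprime pp p∤a (d∣a , d∣p) with prime⇒irreducible pp d∣p
... | inj₁ d≡1  = d≡1
... | inj₂ refl = contradiction d∣a p∤a

-- The exponent is positive, so `p` divides the power and would be a common divisor if it divided
-- `a`. Conversely, coprimality to `p` passes to its powers.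
gcd[a,p^m]≡1⇔p∤a : ∀ {p} → Prime p → ∀ a m → gcd a (p ^ suc m) ≡ 1 ⇔ (¬ p ∣ a)
gcd[a,p^m]≡1⇔p∤a {p} pp a m = mk⇔
  (λ eq p∣a → nonTrivial⇒≢1 {{prime⇒nonTrivial pp}}
    (∣1⇒≡1 (subst (p ∣_) eq (gcd-greatest p∣a (m∣m*n (p ^ m))))))
  (λ p∤a → coprime⇒gcd≡1 (coprime-^ (suc m) (prime∤⇒coprime pp p∤a)))

-- Since `p ∣ n` and `x ≤ n`, the truncated difference `n ∸ x` represents `-x` modulo `p`.
p∣n∸x+y⇔x%p≡y%p : ∀ {p n x} .{{_ : NonZero p}} → p ∣ n → x ≤ n → ∀ y → p ∣ n ∸ x + y ⇔ x % p ≡ y % p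
p∣n∸x+y⇔x%p≡y%p {p} {n} {x} p∣n x≤n y = mk⇔
  (λ p∣d → begin
    x % p                  ≡⟨ %-remove-+ˡ x p∣d ⟨
    (n ∸ x + y + x) % p    ≡⟨ cong (_% p) (trans (+-assoc (n ∸ x) y x) (trans (cong (n ∸ x +_) (+-comm y x)) (sym (+-assoc (n ∸ x) x y)))) ⟩
    (n ∸ x + x + y) % p    ≡⟨ cong (λ z → (z + y) % p) (m∸n+n≡m x≤n) ⟩
    (n + y) % p            ≡⟨ %-remove-+ˡ y p∣n ⟩
    y % p                  ∎)
  (λ x≡y → m%n≡0⇒n∣m (n ∸ x + y) p (begin
    (n ∸ x + y) % p        ≡⟨ %-+ʳ (n ∸ x) y p ⟨
    (n ∸ x + y % p) % p    ≡⟨ cong (λ z → (n ∸ x + z) % p) x≡y ⟨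
    (n ∸ x + x % p) % p    ≡⟨ %-+ʳ (n ∸ x) x p ⟩
    (n ∸ x + x) % p        ≡⟨ cong (_% p) (m∸n+n≡m x≤n) ⟩
    n % p                  ≡⟨ n∣m⇒m%n≡0 n p p∣n ⟩
    0                      ∎))
  where open ≡-Reasoning

-- `combine` writes `i` as `p * d + r` with `r < p`.
toℕ-remainder : ∀ k p .{{_ : NonZero p}} (i : Fin (k * p)) → toℕ (remainder {k} p i) ≡ toℕ i % p
toℕ-remainder k p i = begin
  toℕ r                        ≡⟨ m<n⇒m%n≡m (toℕ<n r) ⟨
  toℕ r % p                    ≡⟨ %-remove-+ˡ (toℕ r) (m∣m*n (toℕ d)) ⟨
  (p * toℕ d + toℕ r) % p      ≡⟨ cong (_% p) (toℕ-combine d r) ⟨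
  toℕ (combine d r) % p      ≡⟨ cong (λ j → toℕ j % p) (combine-remQuot {k} p i) ⟩
  toℕ i % p                    ∎
  where
  open ≡-Reasoning
  d = quotient {k} p i
  r = remainder {k} p i

-- Commuting the product first makes `*↔×` divide by `p` instead of `k`; the swap then puts the
-- remainder, which is the residue class mod `p`, in front as the part.
residueCoordinates : ∀ p k → Fin (p * k) ↔ (Fin p × Fin k)
residueCoordinates p k = Compose.inverse (cast-id (*-comm p k))
  (Compose.inverse *↔× (×-comm (Fin k) (Fin p)))

residueClass : ∀ p k → Fin (p * k) → Fin p
residueClass p k x = proj₁ (Inverse.to (residueCoordinates p k) x)

residueClass≡⇔%≡ : ∀ p k .{{_ : NonZero p}} x y →
  residueClass p k x ≡ residueClass p k y ⇔ toℕ x % p ≡ toℕ y % p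
residueClass≡⇔%≡ p k x y = mk⇔
  (λ eq → trans (sym (toℕ-class x)) (trans (cong toℕ eq) (toℕ-class y)))
  (λ eq → toℕ-injective (trans (toℕ-class x) (trans eq (sym (toℕ-class y)))))
  where
  toℕ-class : ∀ z → toℕ (residueClass p k z) ≡ toℕ z % p
  toℕ-class z = trans (toℕ-remainder k p (cast (*-comm p k) z))
    (cong (_% p) (toℕ-cast (*-comm p k) z))

adjacent⇔residueClass≢ : ∀ p m (pp : Prime p) (1<n : 1 < p ^ suc m) x y →
  SimpleGraph.Adj (UnitaryCayleyGraph (p ^ suc m) 1<n) x y ⇔
  (¬ residueClass p (p ^ m) x ≡ residueClass p (p ^ m) y)
adjacent⇔residueClass≢ p m pp 1<n x y = mk⇔
  (λ adj eq → to unit adj (from p∣diff⇔ (to class eq)))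
  (λ neq → from unit (neq ∘ from class ∘ to p∣diff⇔))
  where
  open Equivalence
  instance
    _ = prime⇒nonZero pp
    _ = >-nonZero (<-trans z<s 1<n)
  n = p ^ suc m
  p∣n = m∣m*n {p} (p ^ m)
  diff = toℕ (Group._∙_ (ℤ/ n) (Group._⁻¹ (ℤ/ n) x) y)

  unit : gcd diff n ≡ 1 ⇔ (¬ p ∣ diff)
  unit = gcd[a,p^m]≡1⇔p∤a pp diff m

  class : residueClass p (p ^ m) x ≡ residueClass p (p ^ m) y ⇔ toℕ x % p ≡ toℕ y % p
  class = residueClass≡⇔%≡ p (p ^ m) x y

  diff≡ : diff ≡ (n ∸ toℕ x + toℕ y) % n
  diff≡ = trans (toℕ-mod _ n)
    (trans (cong (λ z → (z + toℕ y) % n) (toℕ-mod _ n)) (%-+ˡ (n ∸ toℕ x) (toℕ y) n))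

  p∣diff⇔ : p ∣ diff ⇔ toℕ x % p ≡ toℕ y % p
  -- As `p ∣ n`, reduction modulo `n` does not affect divisibility by `p`.
  p∣diff⇔ = mk⇔
    (λ p∣d → to cong-mod (∣n∣m%n⇒∣m p∣n (subst (p ∣_) diff≡ p∣d)))
    (λ eq → subst (p ∣_) (sym diff≡) (%-presˡ-∣ (from cong-mod eq) p∣n))
    where
    cong-mod = p∣n∸x+y⇔x%p≡y%p p∣n (toℕ≤n x) (toℕ y)

theorem3p1 : (p m : ℕ) (p-prime : Prime p) (m≥1 : m ≥ 1) →
    Aut (UnitaryCayleyGraph (p ^ m) (1<p^m p-prime m≥1)) ≅ Sym (p ^ (m ∸ 1)) wrSym p
theorem3p1 p (suc m) p-prime m≥1 = CompleteMultipartite.Aut≅wreath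
  (UnitaryCayleyGraph (p ^ suc m) 1<n)
  (residueCoordinates p (p ^ m))
  (adjacent⇔residueClass≢ p m p-prime 1<n)
  -- The base point is 0, which exists because `p ^ m` is positive.
  (fromℕ< (m^n>0 p {{prime⇒nonZero p-prime}} m))
  where
  1<n : 1 < p ^ suc m
  1<n = 1<p^m p-prime m≥1
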